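{- The edge-forcing number of the butterfly network $BF(4)$ is $25$: $\zeta_e(BF(4))=25$.
   Context: The $r$-dimensional butterfly network $BF(r)$ has vertex set $\{[w;i] : w\in\{0,1\}^r,\ 0\le i\le r\}$, and $[w;i]$ is adjacent to $[w';j]$ iff $j=i+1$ and either $w=w'$ or $w$ and $w'$ differ precisely in the $j$-th bit. Forcing (closure) rule: for a graph $G=(V,E)$ and $T\subseteq V$, the closure $C_G(T)$ starts as $T$ and, as long as some vertex of $C_G(T)$ has exactly one neighbor not in $C_G(T)$, that neighbor is added. Edge-forcing set: a set $K$ of pairwise independent edges of $G$ such that, with $T$ the set of endpoints of edges of $K$, $C_G(T)=V$. $\zeta_e(G)$ is the minimum cardinality of an edge-forcing set of $G$. -}

module Defs where

open import Level using (0ℓ)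
open import Data.Nat using (ℕ; suc)
open import Data.Fin using (Fin; inject₁) renaming (suc to fsuc)
open import Data.Bool using (Bool; not)
open import Data.Vec using (Vec; updateAt)
open import Data.Product using (_×_; _,_; Σ; proj₁; proj₂)
open import Data.Sum using (_⊎_)
open import Data.List using (List; []; _∷_; length; concatMap)
open import Data.List.Relation.Unary.All using (All)
open import Data.List.Relation.Unary.Unique.Propositional using (Unique)
open import Data.List.Membership.Propositional using (_∈_)
open import Relation.Binary.PropositionalEquality using (_≡_; _≢_)

record Graph : Set₁ where
  field
    Vertex : Set
    Adj    : Vertex → Vertex → Set
open Graph public

-- Closure C_G(T) of a vertex set T (given as a list of vertices).
-- It is the least set containing T and closed under the forcing rule:
-- if u is in the set, v is a neighbour of u, and every neighbour of u
-- other than v is already in the set (so v is the unique neighbour of u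
-- outside the set), then v is in the set.  This is exactly the result of
-- the iterative procedure (which is confluent, since the rule is monotone).

data InClosure (G : Graph) (T : List (Vertex G)) : Vertex G → Set where
  base  : ∀ {v} → v ∈ T → InClosure G T v
  force : ∀ {u v} → InClosure G T u → Adj G u v →
          (∀ w → Adj G u w → w ≢ v → InClosure G T w) →
          InClosure G T v

-- Edge-forcing sets.  K is a list of edges (u , v); pairwise independence
-- (no two edges share an endpoint, in particular the edges are distinct)
-- is expressed by the list of all endpoints being duplicate-free.

endpoints : {V : Set} → List (V × V) → List V
endpoints = concatMap (λ e → proj₁ e ∷ proj₂ e ∷ [])

record IsEdgeForcingSet (G : Graph) (K : List (Vertex G × Vertex G)) : Set where
  field
    areEdges    : All (λ e → Adj G (proj₁ e) (proj₂ e)) K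
    independent : Unique (endpoints K)
    forcesAll   : ∀ v → InClosure G (endpoints K) v

EdgeForcingNumber : Graph → ℕ → Set
EdgeForcingNumber G m =
  Σ (List (Vertex G × Vertex G)) (λ K → IsEdgeForcingSet G K × length K ≡ m)
  × (∀ K → IsEdgeForcingSet G K → m Data.Nat.≤ length K)

-- The r-dimensional butterfly network BF(r).
-- Vertex [w;i] is (w , i) with w ∈ {0,1}^r and i ∈ {0,…,r}.
-- Bits are indexed 1..r in the paper; bit j is position j-1 of the vector.
-- [w;i] ~ [w';i+1] iff w' = w or w' differs from w exactly in bit i+1,
-- i.e. position k = i of the vector (k : Fin r, i = inject₁ k, i+1 = suc k).

BFVertex : ℕ → Set
BFVertex r = Vec Bool r × Fin (suc r)

data BFArc (r : ℕ) : BFVertex r → BFVertex r → Set where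
  straight : ∀ (w : Vec Bool r) (k : Fin r) →
             BFArc r (w , inject₁ k) (w , fsuc k)
  cross    : ∀ (w : Vec Bool r) (k : Fin r) →
             BFArc r (w , inject₁ k) (updateAt w k not , fsuc k)

BF : ℕ → Graph
BF r = record
  { Vertex = BFVertex r
  ; Adj    = λ x y → BFArc r x y ⊎ BFArc r y x
  }

{-# OPTIONS --safe #-}

-- Lower bound.  Every edge has exactly one endpoint on an even level, so it suffices to find 25
-- vertices on levels 0, 2, 4 among the endpoints T.  Vertices of level 0 (and of level 4) come in
-- twin pairs with the same neighbours, and T meets all 16 of them.  Grant the process all of levels
-- 1 and 3.  Level 2 then splits, for each of the two sides, into 4 groups of two pairs
-- ({w , w'} being a pair if w and w' have the same two neighbours on that side).  A half-coloured
-- pair can be completed once its group is open, i.e. once one of the twin pairs behind the group is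
-- full, and a group opens once one of its pairs is full.  So
--   (uncoloured level-2 vertices) + Σ_groups (number of full pairs if open, 1 otherwise)
-- never decreases, and it is at most 15 just before the last level-2 vertex is coloured.
-- Initially it is at least 24 − |S| − |O|, where S is the part of T on level 2 and O the set of
-- open groups, so |S| + |O| ≥ 9; and T has at least 16 + |O| vertices on levels 0 and 4.

module Submission where

open import Defs
open import Data.Bool using (Bool; true; false; not; _∧_; _∨_; if_then_else_)
open import Data.Bool.Properties using (not-involutive; ¬-not)
import Data.Bool.Properties as Bool
open import Data.Fin using (Fin; inject₁) renaming (suc to fsuc)
open import Data.Fin.Patterns
import Data.Fin.Properties as Fin
open import Data.List using (List; []; _∷_; length; map)
open import Data.List.Relation.Unary.All as All using (All; []; _∷_)
import Data.List.Relation.Unary.All.Properties as All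
open import Data.List.Relation.Unary.Any using (here; there)
open import Data.List.Relation.Unary.AllPairs using (allPairs?)
open import Data.List.Membership.Propositional using (_∈_)
import Data.List.Membership.DecPropositional as DecMembership
open import Data.Nat using (ℕ; zero; suc; _+_; _≤_; _<_; z≤n; s≤s; s≤s⁻¹)
open import Data.Nat.Properties hiding (_≟_)
open import Data.Nat.ListAction using (sum)
open import Data.Nat.Tactic.RingSolver using (solve-∀)
open import Data.Product using (_×_; _,_; proj₁; proj₂; ∃; ∃₂)
import Data.Product.Properties as Product
open import Data.Sum using (_⊎_; inj₁; inj₂)
open import Data.Unit using (⊤; tt)
open import Data.Vec using (Vec; []; _∷_; updateAt)
import Data.Vec.Properties as Vec
open import Function using (_∘_; case_of_)
open import Relation.Binary.Definitions using (DecidableEquality)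
open import Relation.Binary.PropositionalEquality
open import Relation.Nullary using (¬_; Dec; yes; no; does; contradiction)
open import Relation.Nullary using (¬?; _×-dec_; _⊎-dec_; _→-dec_)
open import Relation.Nullary.Decidable using (dec-true; dec-false; from-yes)
open import Relation.Unary using (Pred; Decidable)

private
  variable
    n : ℕ

-- Sums over bit vectors

𝟙 : Bool → ℕ
𝟙 b = if b then 1 else 0

𝟙-mono : ∀ {a b} → (a ≡ true → b ≡ true) → 𝟙 a ≤ 𝟙 b
𝟙-mono {false}         _   = z≤n
𝟙-mono {true} {true}  _   = ≤-refl
𝟙-mono {true} {false} a⇒b = case a⇒b refl of λ ()

𝟙≤1 : ∀ b → 𝟙 b ≤ 1
𝟙≤1 false = z≤n
𝟙≤1 true  = ≤-refl

∑ : (Vec Bool n → ℕ) → ℕ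
∑ {zero}  f = f []
∑ {suc n} f = ∑ (f ∘ (false ∷_)) + ∑ (f ∘ (true ∷_))

∑-mono-≤ : {f g : Vec Bool n → ℕ} → (∀ v → f v ≤ g v) → ∑ f ≤ ∑ g
∑-mono-≤ {zero}  f≤g = f≤g []
∑-mono-≤ {suc n} f≤g = +-mono-≤ (∑-mono-≤ (f≤g ∘ (false ∷_))) (∑-mono-≤ (f≤g ∘ (true ∷_)))

∑-mono-< : {f g : Vec Bool n → ℕ} → (∀ v → f v ≤ g v) → ∀ v → f v < g v → ∑ f < ∑ g
∑-mono-< f≤g []          f<g = f<g
∑-mono-< f≤g (false ∷ v) f<g =
  +-mono-<-≤ (∑-mono-< (f≤g ∘ (false ∷_)) v f<g) (∑-mono-≤ (f≤g ∘ (true ∷_)))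
∑-mono-< f≤g (true ∷ v)  f<g =
  +-mono-≤-< (∑-mono-≤ (f≤g ∘ (false ∷_))) (∑-mono-< (f≤g ∘ (true ∷_)) v f<g)

-- Bounds the effect of a change at one point: one vertex inserted into a set, or one entry added to
-- a list whose members are counted.
∑-≤-suc : {f g : Vec Bool n → ℕ} (v : Vec Bool n) →
          (∀ w → w ≢ v → f w ≤ g w) → f v ≤ suc (g v) → ∑ f ≤ suc (∑ g)
∑-≤-suc []          f≤g fv≤ = fv≤
∑-≤-suc (false ∷ v) f≤g fv≤ =
  +-mono-≤ (∑-≤-suc v (λ w w≢v → f≤g (false ∷ w) λ { refl → w≢v refl }) fv≤)
           (∑-mono-≤ λ w → f≤g (true ∷ w) λ ())
∑-≤-suc {f = f} {g} (true ∷ v) f≤g fv≤ =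
  ≤-trans (+-mono-≤ (∑-mono-≤ λ w → f≤g (false ∷ w) λ ())
                    (∑-≤-suc v (λ w w≢v → f≤g (true ∷ w) λ { refl → w≢v refl }) fv≤))
          (≤-reflexive (+-suc (∑ (g ∘ (false ∷_))) _))

+-interchange : ∀ a b c d → (a + b) + (c + d) ≡ (a + c) + (b + d)
+-interchange = solve-∀

∑-distrib-+ : (f g : Vec Bool n → ℕ) → ∑ (λ v → f v + g v) ≡ ∑ f + ∑ g
∑-distrib-+ {zero}  f g = refl
∑-distrib-+ {suc n} f g
  rewrite ∑-distrib-+ (f ∘ (false ∷_)) (g ∘ (false ∷_))
        | ∑-distrib-+ (f ∘ (true ∷_)) (g ∘ (true ∷_))
  = +-interchange (∑ (f ∘ (false ∷_))) _ _ _

search : ∀ {p} {P : Pred (Vec Bool n) p} → Decidable P → (∃ λ v → ¬ P v) ⊎ (∀ v → P v)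
search {zero} P? with P? []
... | yes p = inj₂ λ { [] → p }
... | no ¬p = inj₁ ([] , ¬p)
search {suc n} P? with search (P? ∘ (false ∷_)) | search (P? ∘ (true ∷_))
... | inj₁ (v , ¬p) | _             = inj₁ (false ∷ v , ¬p)
... | inj₂ _        | inj₁ (v , ¬p) = inj₁ (true ∷ v , ¬p)
... | inj₂ p        | inj₂ q        = inj₂ λ { (false ∷ v) → p v ; (true ∷ v) → q v }

all? : ∀ {p} {P : Pred (Vec Bool n) p} → Decidable P → Dec (∀ v → P v)
all? P? with search P?
... | inj₁ (v , ¬p) = no λ p → ¬p (p v)
... | inj₂ p        = yes p

-- Bit-vector sets

_≟_ : DecidableEquality (Vec Bool n)
_≟_ = Vec.≡-dec Bool._≟_

infix 4 _⊆_
_⊆_ : (f g : Vec Bool n → Bool) → Set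
f ⊆ g = ∀ v → f v ≡ true → g v ≡ true

insert : Vec Bool n → (Vec Bool n → Bool) → Vec Bool n → Bool
insert v f w = does (w ≟ v) ∨ f w

⊆-insert : (v : Vec Bool n) (f : Vec Bool n → Bool) → f ⊆ insert v f
⊆-insert v f w fw with does (w ≟ v)
... | true  = refl
... | false = fw

insert-∋ : (v : Vec Bool n) (f : Vec Bool n → Bool) → insert v f v ≡ true
insert-∋ v f rewrite dec-true (v ≟ v) refl = refl

insert-≢ : ∀ {v w : Vec Bool n} (f : Vec Bool n → Bool) → w ≢ v → insert v f w ≡ f w
insert-≢ {v = v} {w} f w≢v rewrite dec-false (w ≟ v) w≢v = refl

size co-size : (Vec Bool n → Bool) → ℕ
size    f = ∑ (𝟙 ∘ f)
co-size f = ∑ (𝟙 ∘ not ∘ f)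

co-size-insert-< : ∀ {v : Vec Bool n} f → f v ≡ false → co-size (insert v f) < co-size f
co-size-insert-< {v = v} f fv = ∑-mono-< pointwise v strict
  where
  pointwise : ∀ w → 𝟙 (not (insert v f w)) ≤ 𝟙 (not (f w))
  pointwise w with does (w ≟ v)
  ... | true  = z≤n
  ... | false = ≤-refl
  strict : 𝟙 (not (insert v f v)) < 𝟙 (not (f v))
  strict rewrite insert-∋ v f | fv = ≤-refl

co-size-≤-insert : (v : Vec Bool n) (f : Vec Bool n → Bool) → co-size f ≤ suc (co-size (insert v f))
co-size-≤-insert v f = ∑-≤-suc v (λ w w≢v → ≤-reflexive (cong (𝟙 ∘ not) (sym (insert-≢ f w≢v))))
                                 (≤-trans (𝟙≤1 _) (s≤s z≤n))

co-size-all : (f : Vec Bool n → Bool) → (∀ v → f v ≡ true) → co-size f ≤ ∑ {n} λ _ → 0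
co-size-all f all = ∑-mono-≤ λ v → ≤-reflexive (cong (𝟙 ∘ not) (all v))

-- The process on level 2

Word : Set
Word = Vec Bool 4

-- The upper half of BF(4) is the lower half with words reversed.  On side s, a word is written
-- q ∷ m ∷ g ∷ h with q the bit flipped between the outermost levels and m the bit flipped next.
orient : Bool → Word → Word
orient false w                     = w
orient true  (a ∷ b ∷ c ∷ d ∷ []) = d ∷ c ∷ b ∷ a ∷ []

full : (Word → Bool) → Bool → Bool → Bool → Bool → Bool
full S s q g h = S (orient s (q ∷ false ∷ g ∷ h ∷ [])) ∧ S (orient s (q ∷ true ∷ g ∷ h ∷ []))

-- The group s ∷ g ∷ h has the two pairs q = false and q = true.
Groups : Set
Groups = Vec Bool 3 → Bool

-- A closed group counts 1 so that opening it, which takes a full pair, cannot lower the sum. An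
-- open group earns 1 for each pair completed in it, which offsets the vertex just coloured.
gain : (Word → Bool) → Groups → Vec Bool 3 → ℕ
gain S O x@(s ∷ g ∷ h ∷ []) = if O x then 𝟙 (full S s false g h) + 𝟙 (full S s true g h) else 1

potential : (Word → Bool) → Groups → ℕ
potential S O = co-size S + ∑ (gain S O)

-- Both rules reflect forcing by odd-level vertices. The odd neighbours of a full pair force the
-- second twin of each twin pair behind the group; the neighbours of a full twin pair complete
-- half-coloured pairs.
record Stable (S : Word → Bool) (O : Groups) : Set where
  field
    opened : ∀ s q g h → full S s q g h ≡ true → O (s ∷ g ∷ h ∷ []) ≡ true
    filled : ∀ s q m g h → O (s ∷ g ∷ h ∷ []) ≡ true →
             S (orient s (q ∷ not m ∷ g ∷ h ∷ [])) ≡ true → S (orient s (q ∷ m ∷ g ∷ h ∷ [])) ≡ true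

∧-intro : ∀ {a b} → a ≡ true → b ≡ true → a ∧ b ≡ true
∧-intro refl refl = refl

∧-mono : ∀ {a b c d} → (a ≡ true → c ≡ true) → (b ≡ true → d ≡ true) → a ∧ b ≡ true → c ∧ d ≡ true
∧-mono {true} {true} f g _ = ∧-intro (f refl) (g refl)

full-mono : ∀ {S S′} → S ⊆ S′ → ∀ s q g h → full S s q g h ≡ true → full S′ s q g h ≡ true
full-mono S⊆S′ s q g h = ∧-mono (S⊆S′ _) (S⊆S′ _)

full-intro : ∀ S s q m g h → S (orient s (q ∷ not m ∷ g ∷ h ∷ [])) ≡ true →
             S (orient s (q ∷ m ∷ g ∷ h ∷ [])) ≡ true → full S s q g h ≡ true
full-intro S s q false g h p r = ∧-intro r p
full-intro S s q true  g h p r = ∧-intro p r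

not-full : ∀ S s q m g h → S (orient s (q ∷ m ∷ g ∷ h ∷ [])) ≡ false → full S s q g h ≡ false
not-full S s q false g h p rewrite p = refl
not-full S s q true  g h p rewrite p = Bool.∧-zeroʳ _

gain-mono : ∀ {S S′} O → S ⊆ S′ → ∀ x → gain S O x ≤ gain S′ O x
gain-mono {S} {S′} O S⊆S′ x@(s ∷ g ∷ h ∷ []) with O x
... | false = ≤-refl
... | true  = +-mono-≤ (𝟙-mono (full-mono {S} {S′} S⊆S′ s false g h))
                       (𝟙-mono (full-mono {S} {S′} S⊆S′ s true g h))

gain-mono-< : ∀ {S S′} O → S ⊆ S′ → ∀ s q g h → O (s ∷ g ∷ h ∷ []) ≡ true →
              full S s q g h ≡ false → full S′ s q g h ≡ true →
              gain S O (s ∷ g ∷ h ∷ []) < gain S′ O (s ∷ g ∷ h ∷ [])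
gain-mono-< {S} {S′} O S⊆S′ s false g h o before after rewrite o | before | after =
  s≤s (𝟙-mono (full-mono {S} {S′} S⊆S′ s true g h))
gain-mono-< {S} {S′} O S⊆S′ s true g h o before after rewrite o | before | after =
  +-mono-≤-< (𝟙-mono (full-mono {S} {S′} S⊆S′ s false g h)) (s≤s z≤n)

gain-cong : ∀ S O O′ x → O x ≡ O′ x → gain S O x ≡ gain S O′ x
gain-cong S O O′ (_ ∷ _ ∷ _ ∷ []) eq rewrite eq = refl

gain-closed : ∀ S O x → O x ≡ false → gain S O x ≡ 1
gain-closed S O (_ ∷ _ ∷ _ ∷ []) o rewrite o = refl

gain-open : ∀ S O s q g h → full S s q g h ≡ true → O (s ∷ g ∷ h ∷ []) ≡ true →
            1 ≤ gain S O (s ∷ g ∷ h ∷ [])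
gain-open S O s false g h f o rewrite o | f = s≤s z≤n
gain-open S O s true  g h f o rewrite o | f = m≤n+m 1 _

gain≤2 : ∀ S O x → gain S O x ≤ 2
gain≤2 S O x@(s ∷ g ∷ h ∷ []) with O x
... | false = s≤s z≤n
... | true  = +-mono-≤ (𝟙≤1 (full S s false g h)) (𝟙≤1 (full S s true g h))

gain<2 : ∀ S O s q g h → full S s q g h ≡ false → gain S O (s ∷ g ∷ h ∷ []) < 2
gain<2 S O s q g h f with O (s ∷ g ∷ h ∷ [])
gain<2 S O s q     g h f | false = ≤-refl
gain<2 S O s false g h f | true rewrite f = s≤s (𝟙≤1 _)
gain<2 S O s true  g h f | true rewrite f = s≤s (+-mono-≤ (𝟙≤1 (full S s false g h)) z≤n)

-- Colouring the vertex costs 1 in `co-size`. This is repaid by its pair on side `s`, which becomes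
-- full in an open group, and no other gain drops on either side.
potential-insert-vertex : ∀ S O s q m g h → O (s ∷ g ∷ h ∷ []) ≡ true →
  S (orient s (q ∷ not m ∷ g ∷ h ∷ [])) ≡ true → S (orient s (q ∷ m ∷ g ∷ h ∷ [])) ≡ false →
  potential S O ≤ potential (insert (orient s (q ∷ m ∷ g ∷ h ∷ [])) S) O
potential-insert-vertex S O s q m g h o present absent = begin
  co-size S + ∑ (gain S O)        ≤⟨ +-monoˡ-≤ _ (co-size-≤-insert v S) ⟩
  suc (co-size S′ + ∑ (gain S O)) ≡⟨ +-suc _ _ ⟨
  co-size S′ + suc (∑ (gain S O)) ≤⟨ +-monoʳ-≤ (co-size S′) gains ⟩
  co-size S′ + ∑ (gain S′ O)      ∎
  where
  open ≤-Reasoning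
  v = orient s (q ∷ m ∷ g ∷ h ∷ [])
  S′ = insert v S
  gains : ∑ (gain S O) < ∑ (gain S′ O)
  gains = ∑-mono-< (gain-mono {S} {S′} O (⊆-insert v S)) (s ∷ g ∷ h ∷ [])
    (gain-mono-< {S} {S′} O (⊆-insert v S) s q g h o (not-full S s q m g h absent)
      (full-intro S′ s q m g h (⊆-insert v S _ present) (insert-∋ v S)))

-- While closed the group has gain exactly 1, and its full pair keeps the gain at least 1
-- afterwards.
potential-insert-group : ∀ S O s q g h → full S s q g h ≡ true → O (s ∷ g ∷ h ∷ []) ≡ false →
  potential S O ≤ potential S (insert (s ∷ g ∷ h ∷ []) O)
potential-insert-group S O s q g h f o = +-monoʳ-≤ (co-size S) (∑-mono-≤ pointwise)
  where
  x = s ∷ g ∷ h ∷ []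
  O′ = insert x O
  pointwise : ∀ y → gain S O y ≤ gain S O′ y
  pointwise y with y ≟ x
  ... | yes refl = ≤-trans (≤-reflexive (gain-closed S O x o)) (gain-open S O′ s q g h f (insert-∋ x O))
  ... | no y≢x   = ≤-reflexive (gain-cong S O O′ y (sym (insert-≢ O y≢x)))

-- The coordinates of v on side s are orient s v.
gains-side≤7 : ∀ S O v → S v ≡ false → ∀ s → ∑ (λ gh → gain S O (s ∷ gh)) ≤ 7
gains-side≤7 S O (a ∷ b ∷ c ∷ d ∷ []) absent false =
  s≤s⁻¹ (∑-mono-< (λ gh → gain≤2 S O (false ∷ gh)) (c ∷ d ∷ [])
    (gain<2 S O false a c d (not-full S false a b c d absent)))
gains-side≤7 S O (a ∷ b ∷ c ∷ d ∷ []) absent true =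
  s≤s⁻¹ (∑-mono-< (λ gh → gain≤2 S O (true ∷ gh)) (b ∷ a ∷ [])
    (gain<2 S O true d b a (not-full S true d c b a absent)))

-- The outcome of the process is the least stable state above the start, so this says that level 2
-- gets fully coloured without constructing the outcome. In this form it follows from an invariant
-- of the closure.
Completes : (Word → Bool) → Groups → Set
Completes S O = ∀ S′ O′ → S ⊆ S′ → O ⊆ O′ → Stable S′ O′ → ∀ v → S′ v ≡ true

Completes-mono : ∀ {S S′ O O′} → S ⊆ S′ → O ⊆ O′ → Completes S O → Completes S′ O′
Completes-mono S⊆S′ O⊆O′ completes S″ O″ S′⊆S″ O′⊆O″ =
  completes S″ O″ (λ v → S′⊆S″ v ∘ S⊆S′ v) (λ x → O′⊆O″ x ∘ O⊆O′ x)

refuted : ∀ {a b} → ¬ (a ≡ true → b ≡ true) → a ≡ true × b ≡ false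
refuted {true}  {true}  ¬p = contradiction (λ _ → refl) ¬p
refuted {true}  {false} ¬p = refl , refl
refuted {false} ¬p = contradiction (λ ()) ¬p

refuted₂ : ∀ {a b c} → ¬ (a ≡ true → b ≡ true → c ≡ true) → a ≡ true × b ≡ true × c ≡ false
refuted₂ {true}  ¬p = refl , refuted λ p → ¬p λ _ → p
refuted₂ {false} ¬p = contradiction (λ ()) ¬p

data Progress (S : Word → Bool) (O : Groups) : Set where
  opens  : ∀ s q g h → full S s q g h ≡ true → O (s ∷ g ∷ h ∷ []) ≡ false → Progress S O
  fills  : ∀ s q m g h → O (s ∷ g ∷ h ∷ []) ≡ true →
           S (orient s (q ∷ not m ∷ g ∷ h ∷ [])) ≡ true →
           S (orient s (q ∷ m ∷ g ∷ h ∷ [])) ≡ false → Progress S O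
  stable : Stable S O → Progress S O

progress : ∀ S O → Progress S O
progress S O with search opened? | search filled?
  where
  Opened : Vec Bool 4 → Set
  Opened (s ∷ q ∷ g ∷ h ∷ []) = full S s q g h ≡ true → O (s ∷ g ∷ h ∷ []) ≡ true
  Filled : Vec Bool 5 → Set
  Filled (s ∷ q ∷ m ∷ g ∷ h ∷ []) = O (s ∷ g ∷ h ∷ []) ≡ true →
    S (orient s (q ∷ not m ∷ g ∷ h ∷ [])) ≡ true → S (orient s (q ∷ m ∷ g ∷ h ∷ [])) ≡ true
  opened? : Decidable Opened
  opened? (s ∷ q ∷ g ∷ h ∷ []) = (_ Bool.≟ _) →-dec (_ Bool.≟ _)
  filled? : Decidable Filled
  filled? (s ∷ q ∷ m ∷ g ∷ h ∷ []) = (_ Bool.≟ _) →-dec (_ Bool.≟ _) →-dec (_ Bool.≟ _)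
... | inj₁ (s ∷ q ∷ g ∷ h ∷ [] , ¬opened) | _ =
  let edge , closed = refuted ¬opened in opens s q g h edge closed
... | inj₂ _ | inj₁ (s ∷ q ∷ m ∷ g ∷ h ∷ [] , ¬filled) =
  let group , present , absent = refuted₂ ¬filled in fills s q m g h group present absent
... | inj₂ opened | inj₂ filled = stable record
  { opened = λ s q g h → opened (s ∷ q ∷ g ∷ h ∷ [])
  ; filled = λ s q m g h → filled (s ∷ q ∷ m ∷ g ∷ h ∷ [])
  }

-- No step lowers the potential, so the bound that holds just before the last colouring carries back
-- to the start. The word `v` witnesses that the state is unfinished; the fuel `k` bounds uncoloured
-- vertices plus closed groups, a number that every step lowers.
potential≤15 : ∀ k S O → co-size S + co-size O < k → Completes S O →
               ∀ v → S v ≡ false → potential S O ≤ 15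
potential≤15 (suc k) S O (s≤s left) completes v absent with progress S O
... | stable st =
  contradiction (trans (sym absent) (completes S O (λ _ p → p) (λ _ p → p) st v)) λ ()
... | opens s q g h edge closed =
  ≤-trans (potential-insert-group S O s q g h edge closed)
    (potential≤15 k S O′ (<-≤-trans (+-monoʳ-< (co-size S) (co-size-insert-< O closed)) left)
      (Completes-mono {S} {S} {O} {O′} (λ _ p → p) (⊆-insert _ O) completes) v absent)
  where O′ = insert (s ∷ g ∷ h ∷ []) O
... | fills s q m g h group present absent′
  with search (λ w → insert (orient s (q ∷ m ∷ g ∷ h ∷ [])) S w Bool.≟ true)
...   | inj₂ all =
  -- One uncoloured vertex is left. Each side has four groups of gain at most 2, and the one
  -- containing `v` falls short, whence 1 + 7 + 7.
  +-mono-≤ (≤-trans (co-size-≤-insert u S) (s≤s (co-size-all (insert u S) all)))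
           (+-mono-≤ (gains-side≤7 S O v absent false) (gains-side≤7 S O v absent true))
  where u = orient s (q ∷ m ∷ g ∷ h ∷ [])
...   | inj₁ (w , ¬present) =
  ≤-trans (potential-insert-vertex S O s q m g h group present absent′)
    (potential≤15 k S′ O (<-≤-trans (+-monoˡ-< (co-size O) (co-size-insert-< S absent′)) left)
      (Completes-mono {S} {S′} {O} {O} (⊆-insert _ S) (λ _ p → p) completes) w (¬-not ¬present))
  where S′ = insert (orient s (q ∷ m ∷ g ∷ h ∷ [])) S

-- Each of 16 vertices is counted in `co-size S` or `size S`, and each of 8 groups is open or has
-- gain 1. So the potential plus `size S + size O` is at least 24, while an unfinished state has
-- potential at most 15.
size-of-completing : ∀ S O → Completes S O → 9 ≤ size S + size O
size-of-completing S O completes with search (λ v → S v Bool.≟ true)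
... | inj₂ all = ≤-trans (m≤m+n 9 7) (≤-trans size≥16 (m≤m+n (size S) (size O)))
  where
  size≥16 : 16 ≤ size S
  size≥16 = ∑-mono-≤ {4} {f = λ _ → 1} λ v → ≤-reflexive (cong 𝟙 (sym (all v)))
... | inj₁ (v , absent) = +-cancelˡ-≤ 15 9 _ (begin
  24                                                ≤⟨ +-mono-≤ vertices groups ⟩
  (co-size S + size S) + (∑ (gain S O) + size O)    ≡⟨ +-interchange (co-size S) _ _ _ ⟩
  potential S O + (size S + size O)                 ≤⟨ +-monoˡ-≤ _ bound ⟩
  15 + (size S + size O)                            ∎)
  where
  open ≤-Reasoning
  bound = potential≤15 _ S O ≤-refl completes v (¬-not absent)
  not+ : ∀ b → 1 ≤ 𝟙 (not b) + 𝟙 b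
  not+ false = ≤-refl
  not+ true  = ≤-refl
  gain+ : ∀ x → 1 ≤ gain S O x + 𝟙 (O x)
  gain+ x@(_ ∷ _ ∷ _ ∷ []) with O x
  ... | false = ≤-refl
  ... | true  = m≤n+m 1 _
  vertices : 16 ≤ co-size S + size S
  vertices = ≤-trans (∑-mono-≤ {4} (not+ ∘ S)) (≤-reflexive (∑-distrib-+ (𝟙 ∘ not ∘ S) (𝟙 ∘ S)))
  groups : 8 ≤ ∑ (gain S O) + size O
  groups = ≤-trans (∑-mono-≤ {3} gain+) (≤-reflexive (∑-distrib-+ (gain S O) (𝟙 ∘ O)))

-- From the graph to the level-2 process

Vertex₄ : Set
Vertex₄ = BFVertex 4

_≟ᵥ_ : DecidableEquality Vertex₄
_≟ᵥ_ = Product.≡-dec _≟_ Fin._≟_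

open DecMembership _≟ᵥ_ using (_∈?_)

outer inner mid : Bool → Word → Vertex₄
outer s w = orient s w , (if s then 4F else 0F)
inner s w = orient s w , (if s then 3F else 1F)
mid   s w = orient s w , 2F

outer-adj : ∀ s q m g h q′ → Adj (BF 4) (inner s (q ∷ m ∷ g ∷ h ∷ [])) (outer s (q′ ∷ m ∷ g ∷ h ∷ []))
outer-adj false false m g h false = inj₂ (straight _ 0F)
outer-adj false false m g h true  = inj₂ (cross (true ∷ m ∷ g ∷ h ∷ []) 0F)
outer-adj false true  m g h false = inj₂ (cross (false ∷ m ∷ g ∷ h ∷ []) 0F)
outer-adj false true  m g h true  = inj₂ (straight _ 0F)
outer-adj true  false m g h false = inj₁ (straight _ 3F)
outer-adj true  false m g h true  = inj₁ (cross (h ∷ g ∷ m ∷ false ∷ []) 3F)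
outer-adj true  true  m g h false = inj₁ (cross (h ∷ g ∷ m ∷ true ∷ []) 3F)
outer-adj true  true  m g h true  = inj₁ (straight _ 3F)

mid-adj : ∀ s q m g h m′ → Adj (BF 4) (inner s (q ∷ m ∷ g ∷ h ∷ [])) (mid s (q ∷ m′ ∷ g ∷ h ∷ []))
mid-adj false q false g h false = inj₁ (straight _ 1F)
mid-adj false q false g h true  = inj₁ (cross (q ∷ false ∷ g ∷ h ∷ []) 1F)
mid-adj false q true  g h false = inj₁ (cross (q ∷ true ∷ g ∷ h ∷ []) 1F)
mid-adj false q true  g h true  = inj₁ (straight _ 1F)
mid-adj true  q false g h false = inj₂ (straight _ 2F)
mid-adj true  q false g h true  = inj₂ (cross (h ∷ g ∷ true ∷ q ∷ []) 2F)
mid-adj true  q true  g h false = inj₂ (cross (h ∷ g ∷ false ∷ q ∷ []) 2F)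
mid-adj true  q true  g h true  = inj₂ (straight _ 2F)

outer-not-≢ : ∀ s q m g h → outer s (not q ∷ m ∷ g ∷ h ∷ []) ≢ outer s (q ∷ m ∷ g ∷ h ∷ [])
outer-not-≢ false false m g h ()
outer-not-≢ false true  m g h ()
outer-not-≢ true  false m g h ()
outer-not-≢ true  true  m g h ()

mid-not-≢ : ∀ s q m g h → mid s (q ∷ not m ∷ g ∷ h ∷ []) ≢ mid s (q ∷ m ∷ g ∷ h ∷ [])
mid-not-≢ false q false g h ()
mid-not-≢ false q true  g h ()
mid-not-≢ true  q false g h ()
mid-not-≢ true  q true  g h ()

outer≢mid : ∀ s v w → outer s v ≢ mid s w
outer≢mid false v w ()
outer≢mid true  v w ()

-- Odd levels are granted; A s is given in the coordinates of side s.
module _ (A : Bool → Word → Set) (S : Word → Set) where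

  Coloured : Vertex₄ → Set
  Coloured (w , 0F) = A false w
  Coloured (w , 1F) = ⊤
  Coloured (w , 2F) = S w
  Coloured (w , 3F) = ⊤
  Coloured (w , 4F) = A true (orient true w)

  private
    to-outer : ∀ s w → A s w → Coloured (outer s w)
    to-outer false w                     a = a
    to-outer true  (_ ∷ _ ∷ _ ∷ _ ∷ []) a = a

    from-outer : ∀ s w → Coloured (outer s w) → A s w
    from-outer false w                     a = a
    from-outer true  (_ ∷ _ ∷ _ ∷ _ ∷ []) a = a

  module _
    (outer-forced : ∀ s q m g h q′ → A s (not q′ ∷ m ∷ g ∷ h ∷ []) →
      S (orient s (q ∷ false ∷ g ∷ h ∷ [])) → S (orient s (q ∷ true ∷ g ∷ h ∷ [])) →
      A s (q′ ∷ m ∷ g ∷ h ∷ []))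
    (mid-forced : ∀ s q m g h m′ → A s (false ∷ m ∷ g ∷ h ∷ []) → A s (true ∷ m ∷ g ∷ h ∷ []) →
      S (orient s (q ∷ not m′ ∷ g ∷ h ∷ [])) → S (orient s (q ∷ m′ ∷ g ∷ h ∷ [])))
    where

    private
      OthersColoured : Vertex₄ → Vertex₄ → Set
      OthersColoured u v = ∀ x → Adj (BF 4) u x → x ≢ v → Coloured x

      outer-coloured : ∀ s q m g h q′ →
        OthersColoured (inner s (q ∷ m ∷ g ∷ h ∷ [])) (outer s (q′ ∷ m ∷ g ∷ h ∷ [])) →
        Coloured (outer s (q′ ∷ m ∷ g ∷ h ∷ []))
      outer-coloured s q m g h q′ others = to-outer s _ (outer-forced s q m g h q′
        (from-outer s _ (others _ (outer-adj s q m g h (not q′)) (outer-not-≢ s q′ m g h)))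
        (others _ (mid-adj s q m g h false) (outer≢mid s _ _ ∘ sym))
        (others _ (mid-adj s q m g h true) (outer≢mid s _ _ ∘ sym)))

      mid-coloured : ∀ s q m g h m′ →
        OthersColoured (inner s (q ∷ m ∷ g ∷ h ∷ [])) (mid s (q ∷ m′ ∷ g ∷ h ∷ [])) →
        Coloured (mid s (q ∷ m′ ∷ g ∷ h ∷ []))
      mid-coloured s q m g h m′ others = mid-forced s q m g h m′
        (from-outer s _ (others _ (outer-adj s q m g h false) (outer≢mid s _ _)))
        (from-outer s _ (others _ (outer-adj s q m g h true) (outer≢mid s _ _)))
        (others _ (mid-adj s q m g h (not m′)) (mid-not-≢ s q m′ g h))

      -- Levels alternate in parity, so an even-level `v` is forced only by an `inner` vertex. The
      -- arguments passed are the coordinates of `u` on its side, then the flipped bit as it stands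
      -- in `v`.
      forced-coloured : ∀ {u v} → Adj (BF 4) u v → OthersColoured u v → Coloured v
      forced-coloured (inj₁ (straight w 0F)) _ = tt
      forced-coloured (inj₁ (cross    w 0F)) _ = tt
      forced-coloured (inj₁ (straight (a ∷ b ∷ c ∷ d ∷ []) 1F)) = mid-coloured false a b c d b
      forced-coloured (inj₁ (cross    (a ∷ b ∷ c ∷ d ∷ []) 1F)) = mid-coloured false a b c d (not b)
      forced-coloured (inj₁ (straight w 2F)) _ = tt
      forced-coloured (inj₁ (cross    w 2F)) _ = tt
      forced-coloured (inj₁ (straight (a ∷ b ∷ c ∷ d ∷ []) 3F)) = outer-coloured true d c b a d
      forced-coloured (inj₁ (cross    (a ∷ b ∷ c ∷ d ∷ []) 3F)) = outer-coloured true d c b a (not d)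
      forced-coloured (inj₂ (straight (a ∷ b ∷ c ∷ d ∷ []) 0F)) = outer-coloured false a b c d a
      forced-coloured (inj₂ (cross    (a ∷ b ∷ c ∷ d ∷ []) 0F)) = outer-coloured false (not a) b c d a
      forced-coloured (inj₂ (straight w 1F)) _ = tt
      forced-coloured (inj₂ (cross    w 1F)) _ = tt
      forced-coloured (inj₂ (straight (a ∷ b ∷ c ∷ d ∷ []) 2F)) = mid-coloured true d c b a c
      forced-coloured (inj₂ (cross    (a ∷ b ∷ c ∷ d ∷ []) 2F)) = mid-coloured true d (not c) b a c
      forced-coloured (inj₂ (straight w 3F)) _ = tt
      forced-coloured (inj₂ (cross    w 3F)) _ = tt

    -- Turns an invariant colouring into a bound on the closure. It serves twice: with all of level
    -- 2 granted, to treat twin pairs, and with level 2 coloured by a stable state.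
    closure-coloured : ∀ {T v} → (∀ {x} → x ∈ T → Coloured x) → InClosure (BF 4) T v → Coloured v
    closure-coloured T-coloured (base v∈T)              = T-coloured v∈T
    closure-coloured T-coloured (force _ u~v others) =
      forced-coloured u~v λ x u~x x≢v → closure-coloured T-coloured (others x u~x x≢v)

-- Counting even-level vertices

onMid onOuter : Vertex₄ → Bool
onMid (_ , 2F) = true
onMid _        = false
onOuter (_ , 0F) = true
onOuter (_ , 4F) = true
onOuter _        = false

count : (Vertex₄ → Bool) → List Vertex₄ → ℕ
count c T = sum (map (𝟙 ∘ c) T)

skip-head : ∀ y {x} T → y ≢ x → 𝟙 (does (y ∈? x ∷ T)) ≤ 𝟙 (does (y ∈? T))
skip-head y {x} T y≢x rewrite dec-false (y ≟ᵥ x) y≢x = ≤-refl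

-- The left inverse `d` makes `e` injective, so a list entry `x` accounts for at most the one index
-- `d x`, and for none if `c x` is false.
count-≥-∑ : (c : Vertex₄ → Bool) (e : Vec Bool n → Vertex₄) (d : Vertex₄ → Vec Bool n) →
            (∀ v → c (e v) ≡ true) → (∀ v → d (e v) ≡ v) →
            ∀ T → ∑ (λ v → 𝟙 (does (e v ∈? T))) ≤ count c T
count-≥-∑ {n} c e d c∘e d∘e [] = ∑0 n
  where
  ∑0 : ∀ n → ∑ {n} (λ _ → 0) ≤ 0
  ∑0 zero    = z≤n
  ∑0 (suc n) = +-mono-≤ (∑0 n) (∑0 n)
count-≥-∑ c e d c∘e d∘e (x ∷ T) with c x in cx
... | true  = ≤-trans (∑-≤-suc (d x) (λ v v≢dx → skip-head (e v) T λ { refl → v≢dx (sym (d∘e v)) })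
                                     (≤-trans (𝟙≤1 _) (s≤s z≤n)))
                      (s≤s (count-≥-∑ c e d c∘e d∘e T))
... | false = ≤-trans (∑-mono-≤ λ v
                          → skip-head (e v) T λ { refl → case trans (sym (c∘e v)) cx of λ () })
                      (count-≥-∑ c e d c∘e d∘e T)

even-endpoints : ∀ K → All (λ e → Adj (BF 4) (proj₁ e) (proj₂ e)) K →
                 count onMid (endpoints K) + count onOuter (endpoints K) ≡ length K
even-endpoints []            []            = refl
even-endpoints ((u , v) ∷ K) (u~v ∷ edges) =
  trans (interchange (𝟙 (onMid u)) (𝟙 (onMid v)) _ (𝟙 (onOuter u)) (𝟙 (onOuter v)) _)
        (cong₂ _+_ (one-even u~v) (even-endpoints K edges))
  where
  interchange : ∀ a b c a′ b′ c′ → (a + (b + c)) + (a′ + (b′ + c′)) ≡ ((a + b) + (a′ + b′)) + (c + c′)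
  interchange = solve-∀
  one-even-arc : ∀ {u v} → BFArc 4 u v →
    (𝟙 (onMid u) + 𝟙 (onMid v)) + (𝟙 (onOuter u) + 𝟙 (onOuter v)) ≡ 1
  one-even-arc (straight w 0F) = refl
  one-even-arc (straight w 1F) = refl
  one-even-arc (straight w 2F) = refl
  one-even-arc (straight w 3F) = refl
  one-even-arc (cross w 0F) = refl
  one-even-arc (cross w 1F) = refl
  one-even-arc (cross w 2F) = refl
  one-even-arc (cross w 3F) = refl
  one-even : ∀ {u v} → Adj (BF 4) u v →
    (𝟙 (onMid u) + 𝟙 (onMid v)) + (𝟙 (onOuter u) + 𝟙 (onOuter v)) ≡ 1
  one-even         (inj₁ arc) = one-even-arc arc
  one-even {u} {v} (inj₂ arc) =
    trans (cong₂ _+_ (+-comm (𝟙 (onMid u)) _) (+-comm (𝟙 (onOuter u)) _)) (one-even-arc arc)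

∈⇒≡true : ∀ {x : Vertex₄} {T} → x ∈ T → does (x ∈? T) ≡ true
∈⇒≡true {x} {T} = dec-true (x ∈? T)

-- The initial state of the process given by the endpoints

module _ (T : List Vertex₄) (forces : ∀ v → InClosure (BF 4) T v) where

  private
    S₀ : Word → Bool
    S₀ w = does ((w , 2F) ∈? T)

    a₀ : Bool → Word → Bool
    a₀ s w = does (outer s w ∈? T)

    O₀ : Groups
    O₀ (s ∷ g ∷ h ∷ []) = pair false ∨ pair true
      where
      pair : Bool → Bool
      pair m = a₀ s (false ∷ m ∷ g ∷ h ∷ []) ∧ a₀ s (true ∷ m ∷ g ∷ h ∷ [])

    -- Twins have the same neighbours. If neither lies in `T`, each of these neighbours keeps two
    -- uncoloured neighbours and forces neither twin, so the complement of the pair is an invariant.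
    twins : ∀ s m g h → a₀ s (false ∷ m ∷ g ∷ h ∷ []) ∨ a₀ s (true ∷ m ∷ g ∷ h ∷ []) ≡ true
    twins s m g h with outer s (false ∷ m ∷ g ∷ h ∷ []) ∈? T | outer s (true ∷ m ∷ g ∷ h ∷ []) ∈? T
    ... | yes _ | _     = refl
    ... | no _  | yes _ = refl
    ... | no ∉₀ | no ∉₁ = contradiction refl (twin-coloured s _ (closure-coloured A (λ _ → ⊤)
        (λ _ _ _ _ _ _ a _ _ → a) (λ _ _ _ _ _ _ _ _ _ → tt) T-coloured
        (forces (outer s (false ∷ m ∷ g ∷ h ∷ [])))))
      where
      -- `A` ignores the bit `q′` that separates twins, so the hypothesis on one twin is already the
      -- goal for the other.
      A : Bool → Word → Set
      A s′ (q′ ∷ m′ ∷ g′ ∷ h′ ∷ []) = _≢_ {A = Word} (s′ ∷ m′ ∷ g′ ∷ h′ ∷ []) (s ∷ m ∷ g ∷ h ∷ [])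
      twin-coloured : ∀ s w → Coloured A (λ _ → ⊤) (outer s w) → A s w
      twin-coloured false w                     a = a
      twin-coloured true  (_ ∷ _ ∷ _ ∷ _ ∷ []) a = a
      T-coloured : ∀ {x} → x ∈ T → Coloured A (λ _ → ⊤) x
      T-coloured {false ∷ _ ∷ _ ∷ _ ∷ [] , 0F} x∈T refl = ∉₀ x∈T
      T-coloured {true  ∷ _ ∷ _ ∷ _ ∷ [] , 0F} x∈T refl = ∉₁ x∈T
      T-coloured {_ , 1F} _ = tt
      T-coloured {_ , 2F} _ = tt
      T-coloured {_ , 3F} _ = tt
      T-coloured {_ ∷ _ ∷ _ ∷ false ∷ [] , 4F} x∈T refl = ∉₀ x∈T
      T-coloured {_ ∷ _ ∷ _ ∷ true  ∷ [] , 4F} x∈T refl = ∉₁ x∈T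

    O₀-intro : ∀ s m g h → outer s (false ∷ m ∷ g ∷ h ∷ []) ∈ T → outer s (true ∷ m ∷ g ∷ h ∷ []) ∈ T →
               O₀ (s ∷ g ∷ h ∷ []) ≡ true
    O₀-intro s false g h p q rewrite ∈⇒≡true p | ∈⇒≡true q = refl
    O₀-intro s true  g h p q rewrite ∈⇒≡true p | ∈⇒≡true q = Bool.∨-zeroʳ _

    -- Level 2 is coloured by `S`, and an outer vertex counts as coloured if it lies in `T` or its
    -- group is open in `O`. This is invariant: a full pair opens the group, and two coloured twins
    -- mean that the group is open, possibly because both lie in `T`, so that `filled` applies.
    completes : Completes S₀ O₀
    completes S O S₀⊆S O₀⊆O st v = closure-coloured A (λ w → S w ≡ true)
        (λ s q m g h q′ _ p r → inj₂ (opened s q g h (∧-intro p r)))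
        (λ s q m g h m′ p r → filled s q m′ g h (group-open s m g h p r))
        T-coloured (forces (v , 2F))
      where
      open Stable st
      A : Bool → Word → Set
      A s w@(q ∷ m ∷ g ∷ h ∷ []) = outer s w ∈ T ⊎ O (s ∷ g ∷ h ∷ []) ≡ true
      group-open : ∀ s m g h → A s (false ∷ m ∷ g ∷ h ∷ []) → A s (true ∷ m ∷ g ∷ h ∷ []) →
                   O (s ∷ g ∷ h ∷ []) ≡ true
      group-open s m g h (inj₂ o) _        = o
      group-open s m g h (inj₁ _) (inj₂ o) = o
      group-open s m g h (inj₁ p) (inj₁ r) = O₀⊆O _ (O₀-intro s m g h p r)
      T-coloured : ∀ {x} → x ∈ T → Coloured A (λ w → S w ≡ true) x
      T-coloured {_ ∷ _ ∷ _ ∷ _ ∷ [] , 0F} x∈T = inj₁ x∈T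
      T-coloured {_ , 1F} _   = tt
      T-coloured {w , 2F} x∈T = S₀⊆S w (∈⇒≡true x∈T)
      T-coloured {_ , 3F} _   = tt
      T-coloured {_ ∷ _ ∷ _ ∷ _ ∷ [] , 4F} x∈T = inj₁ x∈T

    -- The group coordinates come first, so a sum over five bits unfolds into a sum over groups of
    -- four outer vertices each.
    outerAt : Vec Bool 5 → Vertex₄
    outerAt (s ∷ g ∷ h ∷ q ∷ m ∷ []) = outer s (q ∷ m ∷ g ∷ h ∷ [])

    -- The twin pairs behind a group are `a`, `b` and `c`, `d`: each gives one vertex, and a full
    -- pair gives a further one. The summands stand in the order in which `∑` runs through `q` and
    -- `m`.
    twins-count : ∀ a b c d → a ∨ b ≡ true → c ∨ d ≡ true →
                  2 + 𝟙 ((a ∧ b) ∨ (c ∧ d)) ≤ (𝟙 a + 𝟙 c) + (𝟙 b + 𝟙 d)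
    twins-count false true  false true  _ _ = ≤-refl
    twins-count false true  true  false _ _ = ≤-refl
    twins-count false true  true  true  _ _ = ≤-refl
    twins-count true  false false true  _ _ = ≤-refl
    twins-count true  false true  false _ _ = ≤-refl
    twins-count true  false true  true  _ _ = ≤-refl
    twins-count true  true  false true  _ _ = ≤-refl
    twins-count true  true  true  false _ _ = ≤-refl
    twins-count true  true  true  true  _ _ = m≤m+n 3 1

    outer-count : 16 + size O₀ ≤ count onOuter T
    outer-count = begin
      16 + size O₀                          ≡⟨ ∑-distrib-+ {3} (λ _ → 2) (𝟙 ∘ O₀) ⟨
      ∑ (λ x → 2 + 𝟙 (O₀ x))                ≤⟨ ∑-mono-≤ per-group ⟩
      ∑ (λ v → 𝟙 (does (outerAt v ∈? T)))   ≤⟨ outer≤ ⟩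
      count onOuter T                       ∎
      where
      open ≤-Reasoning
      groupCount : Vec Bool 3 → ℕ
      groupCount (s ∷ g ∷ h ∷ []) = ∑ {2} λ qm → 𝟙 (does (outerAt (s ∷ g ∷ h ∷ qm) ∈? T))
      per-group : ∀ x → 2 + 𝟙 (O₀ x) ≤ groupCount x
      per-group (s ∷ g ∷ h ∷ []) =
        twins-count (a₀ s (false ∷ false ∷ g ∷ h ∷ [])) _ (a₀ s (false ∷ true ∷ g ∷ h ∷ [])) _
                    (twins s false g h) (twins s true g h)
      -- The second clause is meant for level 4; the entries counted by `onOuter` lie on levels 0
      -- and 4 only.
      decode : Vertex₄ → Vec Bool 5
      decode (q ∷ m ∷ g ∷ h ∷ [] , 0F) = false ∷ g ∷ h ∷ q ∷ m ∷ []
      decode (h ∷ g ∷ m ∷ q ∷ [] , _)  = true ∷ g ∷ h ∷ q ∷ m ∷ []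
      on-outer : ∀ v → onOuter (outerAt v) ≡ true
      on-outer (false ∷ _ ∷ _ ∷ _ ∷ _ ∷ []) = refl
      on-outer (true  ∷ _ ∷ _ ∷ _ ∷ _ ∷ []) = refl
      decode-outerAt : ∀ v → decode (outerAt v) ≡ v
      decode-outerAt (false ∷ _ ∷ _ ∷ _ ∷ _ ∷ []) = refl
      decode-outerAt (true  ∷ _ ∷ _ ∷ _ ∷ _ ∷ []) = refl
      outer≤ = count-≥-∑ onOuter outerAt decode on-outer decode-outerAt T

  even-count≥25 : 25 ≤ count onMid T + count onOuter T
  even-count≥25 = begin
    16 + 9                          ≤⟨ +-monoʳ-≤ 16 (size-of-completing S₀ O₀ completes) ⟩
    16 + (size S₀ + size O₀)        ≡⟨ swap (size S₀) (size O₀) ⟩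
    size S₀ + (16 + size O₀)        ≤⟨ +-mono-≤ mid-count outer-count ⟩
    count onMid T + count onOuter T ∎
    where
    open ≤-Reasoning
    mid-count = count-≥-∑ onMid (_, 2F) proj₁ (λ _ → refl) (λ _ → refl) T
    swap : ∀ a b → 16 + (a + b) ≡ a + (16 + b)
    swap = solve-∀

lower-bound : ∀ K → IsEdgeForcingSet (BF 4) K → 25 ≤ length K
lower-bound K forcing =
  subst (25 ≤_) (even-endpoints K areEdges) (even-count≥25 (endpoints K) forcesAll)
  where open IsEdgeForcingSet forcing

-- Verifying an explicit forcing set

-- Quantifying over the bit position `k` instead of over arcs makes this decidable. The cross
-- neighbour below is again obtained by flipping bit `k`, as the flip is an involution.
AllNeighbours : ∀ {r p} → Pred (BFVertex r) p → Pred (BFVertex r) p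
AllNeighbours P (w , i) = ∀ k →
  (inject₁ k ≡ i → P (w , fsuc k) × P (updateAt w k not , fsuc k)) ×
  (fsuc k ≡ i → P (w , inject₁ k) × P (updateAt w k not , inject₁ k))

allNeighbours? : ∀ {r p} {P : Pred (BFVertex r) p} → Decidable P → Decidable (AllNeighbours P)
allNeighbours? P? (w , i) = Fin.all? λ k →
  ((inject₁ k Fin.≟ i) →-dec (P? _ ×-dec P? _)) ×-dec ((fsuc k Fin.≟ i) →-dec (P? _ ×-dec P? _))

allNeighbours-sound : ∀ {r p} {P : Pred (BFVertex r) p} {u} →
                      AllNeighbours P u → ∀ v → Adj (BF r) u v → P v
allNeighbours-sound all _ (inj₁ (straight w k)) = proj₁ (proj₁ (all k) refl)
allNeighbours-sound all _ (inj₁ (cross w k))    = proj₂ (proj₁ (all k) refl)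
allNeighbours-sound all _ (inj₂ (straight w k)) = proj₁ (proj₂ (all k) refl)
allNeighbours-sound {P = P} all _ (inj₂ (cross w k)) =
  subst (λ w′ → P (w′ , inject₁ k)) flip-flip (proj₂ (proj₂ (all k) refl))
  where
  flip-flip : updateAt (updateAt w k not) k not ≡ w
  flip-flip = trans (Vec.updateAt-updateAt k w) (Vec.updateAt-id-local k w (not-involutive _))

Move : Set
Move = ∃₂ (Adj (BF 4))

-- A decidable check that replays a forcing order: `L` lists the vertices coloured so far, and each
-- move adds its target.
Forces : List Vertex₄ → List Move → Set
Forces L []                   = ∀ i w → (w , i) ∈ L
Forces L ((u , v , _) ∷ moves) =
  u ∈ L × AllNeighbours (λ x → x ≡ v ⊎ x ∈ L) u × Forces (v ∷ L) moves

forces? : ∀ L moves → Dec (Forces L moves)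
forces? L []                    = Fin.all? λ i → all? λ w → (w , i) ∈? L
forces? L ((u , v , _) ∷ moves) =
  (u ∈? L) ×-dec allNeighbours? (λ x → (x ≟ᵥ v) ⊎-dec (x ∈? L)) u ×-dec forces? (v ∷ L) moves

forces-sound : ∀ {T} L moves → (∀ {x} → x ∈ L → InClosure (BF 4) T x) → Forces L moves →
               ∀ v → InClosure (BF 4) T v
forces-sound L [] L⊆ all (w , i) = L⊆ (all i w)
forces-sound {T} L ((u , v , u~v) ∷ moves) L⊆ (u∈L , others , rest) =
  forces-sound (v ∷ L) moves v∷L⊆ rest
  where
  neighbours : ∀ x → Adj (BF 4) u x → x ≡ v ⊎ x ∈ L
  neighbours = allNeighbours-sound {P = λ x → x ≡ v ⊎ x ∈ L} others
  v-forced : InClosure (BF 4) T v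
  v-forced = force (L⊆ u∈L) u~v λ x u~x x≢v → case neighbours x u~x of λ where
    (inj₁ x≡v) → contradiction x≡v x≢v
    (inj₂ x∈L) → L⊆ x∈L
  v∷L⊆ : ∀ {x} → x ∈ v ∷ L → InClosure (BF 4) T x
  v∷L⊆ (here refl) = v-forced
  v∷L⊆ (there x∈L) = L⊆ x∈L

-- The forcing set with 25 edges and its forcing order

pattern O = false
pattern I = true

word : Bool → Bool → Bool → Bool → Word
word a b c d = a ∷ b ∷ c ∷ d ∷ []

up down : ∀ {u v} → BFArc 4 u v → Move
up   arc = _ , _ , inj₁ arc
down arc = _ , _ , inj₂ arc

straightEdge : Word × Fin 4 → Vertex₄ × Vertex₄
straightEdge (w , k) = (w , inject₁ k) , (w , fsuc k)

-- One edge at each of the 16 twin pairs, and nine edges at level 2 with S of size 9 and O empty,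
-- found by computer search.
edges₂₅ : List (Vertex₄ × Vertex₄)
edges₂₅ = map straightEdge (
  (word O O O O , 0F) ∷ (word O O O I , 0F) ∷ (word O O I I , 0F) ∷
  (word O I O O , 0F) ∷ (word O I O I , 0F) ∷ (word O I I O , 0F) ∷
  (word O I I I , 0F) ∷ (word I O I O , 0F) ∷ (word O O I O , 1F) ∷
  (word I O O O , 1F) ∷ (word I O O I , 1F) ∷ (word I O I I , 1F) ∷
  (word I I O I , 1F) ∷ (word I I I O , 1F) ∷ (word I I I I , 1F) ∷
  (word O I O I , 2F) ∷ (word O I I I , 2F) ∷ (word O O O O , 3F) ∷
  (word O O I O , 3F) ∷ (word O I O O , 3F) ∷ (word O I I O , 3F) ∷
  (word I O O O , 3F) ∷ (word I O I O , 3F) ∷ (word I I O O , 3F) ∷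
  (word I I I O , 3F) ∷
  [])

-- One move for each of the 80 - 50 = 30 vertices that are not endpoints, in an order in which they
-- can be forced.
moves₃₀ : List Move
moves₃₀ =
  down (cross (word O O O I) 3F) ∷ down (cross (word O O I I) 3F) ∷
  up (cross (word O I O O) 0F) ∷ up (straight (word O I O I) 3F) ∷
  up (straight (word O I I I) 3F) ∷ down (cross (word I O O I) 3F) ∷
  down (straight (word I O O I) 0F) ∷ up (cross (word I O O I) 2F) ∷
  up (straight (word I O O I) 3F) ∷ down (straight (word I O I I) 0F) ∷
  up (straight (word I O I I) 3F) ∷ down (cross (word I I O I) 3F) ∷
  down (straight (word I I O I) 0F) ∷ up (cross (word I I O I) 2F) ∷
  up (straight (word I I O I) 3F) ∷ down (straight (word I I I I) 0F) ∷
  up (straight (word I I I I) 3F) ∷ up (straight (word O O O I) 1F) ∷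
  up (straight (word O O I I) 1F) ∷ up (straight (word O O I I) 3F) ∷
  down (cross (word I O I O) 2F) ∷ down (cross (word O O I O) 0F) ∷
  down (straight (word I I O O) 2F) ∷ down (straight (word I I I O) 0F) ∷
  up (straight (word O O O I) 3F) ∷ up (cross (word O O I O) 1F) ∷
  down (cross (word O O O O) 2F) ∷ down (straight (word O I O O) 2F) ∷
  down (straight (word I O O O) 0F) ∷ down (straight (word I I O O) 0F) ∷
  []

edges₂₅-forcing : IsEdgeForcingSet (BF 4) edges₂₅
edges₂₅-forcing = record
  { areEdges    = All.map⁺ {f = straightEdge} (All.universal (λ (w , k) → inj₁ (straight w k)) _)
  ; independent = from-yes (allPairs? (λ x y → ¬? (x ≟ᵥ y)) (endpoints edges₂₅))
  ; forcesAll   = forces-sound (endpoints edges₂₅) moves₃₀ base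
                    (from-yes (forces? (endpoints edges₂₅) moves₃₀))
  }

theorem4p5 : EdgeForcingNumber (BF 4) 25
theorem4p5 = (edges₂₅ , edges₂₅-forcing , refl) , lower-bound
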